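{- Let $0<\epsilon<2$ be a constant. For any $k$ permutations $\sigma_1,\dots,\sigma_k:[n]\to[n]$ with $k\le\log\log n-\log\log\frac{2}{\epsilon}-2$ and any arrival order $\pi:[n]\to[n]$, there is a bipartite graph $G=(A,B,E)$ with $A=B=[n]$ that contains a perfect matching and such that for every $i\in\{1,\dots,k\}$, $$|\textsc{Ranking}(G,\pi,\sigma_i)|\le\left(\tfrac12+\epsilon\right)n+o(n).$$
   Context: For a bipartite graph $G=(A,B,E)$, an arrival order $\pi$ of the $A$-vertices and a ranking (permutation) $\sigma$ of the $B$-vertices, $\textsc{Ranking}(G,\pi,\sigma)$ is the matching produced as follows: the $A$-vertices arrive one by one in the order $\pi$, and each arriving vertex $a$ is matched to its unmatched neighbour $b$ of minimum rank $\sigma(b)$; if $a$ has no unmatched neighbour it stays unmatched. $\log$ denotes the binary logarithm.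
   Formalization: The constant ε is taken to be rational rather than real; the condition on k is stated in the equivalent form n ≥ (2/ε)^(2^(k+2)). -}

module Defs where

open import Data.Nat using (ℕ; zero; suc)
open import Data.Fin using (Fin; _≟_)
open import Data.Fin.Permutation using (Permutation′; _⟨$⟩ʳ_; _⟨$⟩ˡ_)
open import Data.Bool using (Bool; true; false; _∧_; not; if_then_else_)
open import Data.List using (List; []; _∷_; map; allFin)
open import Data.Maybe using (Maybe; just; nothing)
open import Data.Product using (Σ; _×_; _,_)
open import Relation.Binary.PropositionalEquality using (_≡_)
open import Data.Integer using (+_)
open import Relation.Nullary using (does)
open import Data.Rational using (ℚ; 1ℚ; _*_; _/_)

-- A bipartite graph G = (A, B, E) with A = B = [n] (= Fin n):
-- E a b ≡ true  iff  {a, b} is an edge (a ∈ A, b ∈ B).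
BipGraph : ℕ → Set
BipGraph n = Fin n → Fin n → Bool

HasPerfectMatching : {n : ℕ} → BipGraph n → Set
HasPerfectMatching {n} G = Σ (Permutation′ n) (λ μ → (a : Fin n) → G a (μ ⟨$⟩ʳ a) ≡ true)

markMatched : {n : ℕ} → (Fin n → Bool) → Fin n → (Fin n → Bool)
markMatched m b b′ = if does (b′ ≟ b) then true else m b′

firstFree : {n : ℕ} → BipGraph n → (Fin n → Bool) → Fin n → List (Fin n) → Maybe (Fin n)
firstFree G m a [] = nothing
firstFree G m a (b ∷ bs) = if G a b ∧ not (m b) then just b else firstFree G m a bs

-- B-vertices listed in increasing rank: σ ⟨$⟩ʳ b is the rank σ(b) of b,
-- so the vertex of rank r is σ ⟨$⟩ˡ r.
byRank : {n : ℕ} → Permutation′ n → List (Fin n)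
byRank {n} σ = map (σ ⟨$⟩ˡ_) (allFin n)

rankingGo : {n : ℕ} → BipGraph n → Permutation′ n → (Fin n → Bool) → List (Fin n) → List (Fin n × Fin n)
rankingGo G σ m [] = []
rankingGo G σ m (a ∷ as) with firstFree G m a (byRank σ)
... | nothing = rankingGo G σ m as
... | just b  = (a , b) ∷ rankingGo G σ (markMatched m b) as

-- Ranking(G, π, σ): π ⟨$⟩ʳ a is the arrival position π(a) of a, so the
-- vertex arriving at step t is π ⟨$⟩ˡ t.  Result: list of matched pairs (a , b).
Ranking : {n : ℕ} → BipGraph n → Permutation′ n → Permutation′ n → List (Fin n × Fin n)
Ranking {n} G π σ = rankingGo G σ (λ _ → false) (map (π ⟨$⟩ˡ_) (allFin n))

_^ℚ_ : ℚ → ℕ → ℚ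
q ^ℚ zero = 1ℚ
q ^ℚ suc m = q * (q ^ℚ m)

ℕ→ℚ : ℕ → ℚ
ℕ→ℚ m = (+ m) / 1

{-# OPTIONS --safe #-}

-- Iterating the Erdős–Szekeres argument, any (2m)^(2^k) + 1 vertices of B contain a sequence
-- b₀, …, b₂ₘ on which every one of the k rankings is monotone, so all but (2m)^(2^k) vertices of B
-- can be partitioned into such sequences. For each sequence let m of the earliest A-vertices
-- a₀, …, aₘ₋₁ have neighbours b₂ⱼ, b₂ⱼ₊₁, b₂ⱼ₊₂, with b₂ⱼ₊₁ the partner of aⱼ in the perfect matching;
-- every later A-vertex is adjacent only to its partner. If the ranking increases along the sequence,
-- aⱼ takes b₂ⱼ, and if it decreases, aⱼ takes b₂ⱼ₊₂. Hence the vertices b₂ⱼ₊₁, a fraction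
-- m / (2m + 1) of the partitioned part of B, stay unmatched. With m = ⌊1/ε⌋ the bound (½ + ε) n
-- holds without any error term.

module Submission where

open import Defs
open import Data.Nat using (ℕ; zero; suc; z≤n; s≤s; s≤s⁻¹) renaming (_+_ to _+ℕ_; _^_ to _^ℕ_; _*_ to _*ℕ_; _≤_ to _≤ℕ_; _<_ to _<ℕ_)
open import Data.Fin using (Fin; zero; suc; toℕ; cast; _≟_)
open import Data.Fin.Permutation using (Permutation′; permutation; _⟨$⟩ʳ_; _⟨$⟩ˡ_; inverseˡ; inverseʳ)
open import Data.List using (List; []; _∷_; _++_; length; map; filter; take; lookup; tabulate; allFin)
open import Data.Product using (Σ; ∃; _×_; _,_; proj₁; proj₂)
open import Data.Rational using (ℚ; mkℚ; 0ℚ; 1ℚ; ½; -_; _+_; _-_; _*_; _≤_; _<_; _≥_; *≤*; *<*; Positive; NonNegative; positive; nonNegative)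

import Data.Nat.Properties as ℕ
open import Data.Bool using (Bool; true; false)
open import Data.Maybe using (just; nothing)
open import Data.Sum using (_⊎_; inj₁; inj₂; [_,_]′)
import Data.Fin.Properties as Fin
open import Data.List.Properties using (length-++; ∷-injective; length-map; length-take; length-tabulate; map-tabulate; map-++; map-∘; map-id; tabulate-cong; tabulate-lookup; filter-notAll)
open import Data.List.Membership.Propositional using (_∈_; _∉_; lose; find)
open import Data.List.Membership.Propositional.Properties using (∈-∃++; ∈-++⁺ˡ; ∈-++⁺ʳ; ∈-++⁻; ∈-map⁺; ∈-map⁻; ∈-filter⁺; ∈-filter⁻; ∈-allFin)
open import Data.List.Relation.Binary.Subset.Propositional using (_⊆_)
open import Data.List.Relation.Binary.Subset.Propositional.Properties using (∈-∷⁺ʳ; ⊆-trans; filter-⊆)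
open import Data.List.Relation.Binary.Disjoint.Propositional using (Disjoint)
open import Data.List.Relation.Binary.Pointwise as Pointwise using (Pointwise; []; _∷_)
open import Data.List.Relation.Unary.All as All using (All; []; _∷_)
open import Data.List.Relation.Unary.Any using (here; there; any?)
open import Data.List.Relation.Unary.AllPairs as AllPairs using (AllPairs; []; _∷_)
open import Data.List.Relation.Unary.All.Properties using (anti-mono)
import Data.List.Relation.Unary.AllPairs.Properties as AllPairs
open import Data.List.Relation.Unary.Unique.Propositional using (Unique)
import Data.List.Relation.Unary.Unique.Propositional.Properties as Unique
open import Function using (_∘_; _on_; id)
open import Level using (0ℓ)
open import Relation.Binary using (Rel; Decidable; Transitive; tri<; tri≈; tri>)
open import Relation.Binary.PropositionalEquality
open import Relation.Nullary using (¬_; Dec; yes; no; does; contradiction; ¬?)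
open import Relation.Nullary.Decidable using (_×-dec_; dec-true)
import Relation.Unary as U
import Data.Integer as ℤ
import Data.Integer.Properties as ℤ
import Data.Rational.Properties as ℚ
import Data.Rational.Unnormalised as ℚᵘ
import Data.Rational.Unnormalised.Properties as ℚᵘ
import Data.Nat.DivMod as ℕ
import Data.Nat.Coprimality as Coprimality
import Data.Nat.Solver as ℕSolver
import Data.Rational.Solver as ℚSolver

-- Lists: sublists, duplicates and splitting

take-⊆ : {A : Set} (i : ℕ) (xs : List A) → take i xs ⊆ xs
take-⊆ (suc i) (x ∷ xs) (here eq) = here eq
take-⊆ (suc i) (x ∷ xs) (there v∈) = there (take-⊆ i xs v∈)

length-filter-split : {A : Set} {P : U.Pred A 0ℓ} (P? : U.Decidable P) (xs : List A) →
  length (filter (¬? ∘ P?) xs) +ℕ length (filter P? xs) ≡ length xs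
length-filter-split P? [] = refl
length-filter-split P? (x ∷ xs) with does (P? x)
... | true = trans (ℕ.+-suc _ _) (cong suc (length-filter-split P? xs))
... | false = cong suc (length-filter-split P? xs)

unique-⊆⇒length≤ : {A : Set} {xs ys : List A} → Unique xs → xs ⊆ ys → length xs ≤ℕ length ys
unique-⊆⇒length≤ [] _ = z≤n
unique-⊆⇒length≤ {xs = x ∷ xs} (x∉ ∷ u) x∷xs⊆ys with ∈-∃++ (x∷xs⊆ys (here refl))
... | us , vs , refl = begin
  suc (length xs)                  ≤⟨ s≤s (unique-⊆⇒length≤ u xs⊆) ⟩
  suc (length (us ++ vs))          ≡⟨ cong suc (length-++ us) ⟩
  suc (length us +ℕ length vs)     ≡⟨ ℕ.+-suc (length us) (length vs) ⟨
  length us +ℕ length (x ∷ vs)     ≡⟨ length-++ us ⟨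
  length (us ++ x ∷ vs)            ∎
  where
  open ℕ.≤-Reasoning
  xs⊆ : xs ⊆ us ++ vs
  xs⊆ v∈ with ∈-++⁻ us (x∷xs⊆ys (there v∈))
  ... | inj₁ v∈us = ∈-++⁺ˡ v∈us
  ... | inj₂ (here refl) = contradiction refl (All.lookup x∉ v∈)
  ... | inj₂ (there v∈vs) = ∈-++⁺ʳ us v∈vs

unique-map⇒injective : {A B : Set} (f : A → B) {xs : List A} {x y : A} →
  Unique (map f xs) → x ∈ xs → y ∈ xs → f x ≡ f y → x ≡ y
unique-map⇒injective f u (here refl) (here refl) eq = refl
unique-map⇒injective f (h ∷ u) (here refl) (there y∈) eq = contradiction eq (All.lookup h (∈-map⁺ f y∈))
unique-map⇒injective f (h ∷ u) (there x∈) (here refl) eq = contradiction (sym eq) (All.lookup h (∈-map⁺ f x∈))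
unique-map⇒injective f (h ∷ u) (there x∈) (there y∈) eq = unique-map⇒injective f u x∈ y∈ eq

map-++⁻ : {A B : Set} (f : A → B) (xs : List A) (us : List B) {vs : List B} → map f xs ≡ us ++ vs →
  ∃ λ ys → ∃ λ zs → xs ≡ ys ++ zs × map f ys ≡ us × map f zs ≡ vs
map-++⁻ f xs [] eq = [] , xs , refl , refl , eq
map-++⁻ f (x ∷ xs) (u ∷ us) eq with ∷-injective eq
... | refl , eq′ with ys , zs , refl , refl , refl ← map-++⁻ f xs us eq′ = x ∷ ys , zs , refl , refl , refl

tabulate-lookup-cast : {A : Set} {n : ℕ} (xs : List A) (eq : n ≡ length xs) →
  tabulate (lookup xs ∘ cast eq) ≡ xs
tabulate-lookup-cast xs refl =
  trans (tabulate-cong (cong (lookup xs) ∘ Fin.cast-is-id refl)) (tabulate-lookup xs)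

-- The implication may use membership in the list: that two minimal elements are incomparable
-- follows from their having survived the filter, not from `S`.
AllPairs-resp-all : {A : Set} {S T : Rel A 0ℓ} {xs : List A} →
  (∀ {x y} → x ∈ xs → y ∈ xs → S x y → T x y) → AllPairs S xs → AllPairs T xs
AllPairs-resp-all f [] = []
AllPairs-resp-all f (h ∷ t) =
  All.tabulate (λ y∈ → f (here refl) (there y∈) (All.lookup h y∈)) ∷
  AllPairs-resp-all (λ x∈ y∈ → f (there x∈) (there y∈)) t

-- Simultaneously monotone sequences

-- The elements without a predecessor in l form an antichain; if it is short, a chain among the
-- remaining elements extends downwards by one.
chain-or-antichain : {A : Set} {P S : Rel A 0ℓ} → Decidable P → Transitive P →
  ∀ q r (l : List A) → AllPairs S l → q *ℕ r <ℕ length l →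
  (∃ λ c → c ⊆ l × length c ≡ suc q × AllPairs P c) ⊎
  (∃ λ c → c ⊆ l × length c ≡ suc r × AllPairs (λ x y → S x y × ¬ P x y) c)
chain-or-antichain P? P-trans zero r (x ∷ l) Sl _ =
  inj₁ (x ∷ [] , (λ { (here refl) → here refl }) , refl , [] ∷ [])
chain-or-antichain {A} {P} {S} P? P-trans (suc q) r l Sl long = split (ℕ.<-≤-connex r (length minimal))
  where
  hasPred? : U.Decidable _
  hasPred? x = any? (λ y → P? y x) l
  minimal others : List A
  minimal = filter (¬? ∘ hasPred?) l
  others = filter hasPred? l
  antichain : AllPairs (λ x y → S x y × ¬ P x y) minimal
  antichain = AllPairs-resp-all
    (λ x∈ y∈ Sxy → Sxy , λ Pxy →
      proj₂ (∈-filter⁻ (¬? ∘ hasPred?) {xs = l} y∈) (lose (filter-⊆ (¬? ∘ hasPred?) l x∈) Pxy))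
    (AllPairs.filter⁺ (¬? ∘ hasPred?) Sl)
  Goal : Set
  Goal = (∃ λ c → c ⊆ l × length c ≡ suc (suc q) × AllPairs P c) ⊎
         (∃ λ c → c ⊆ l × length c ≡ suc r × AllPairs (λ x y → S x y × ¬ P x y) c)
  extend : (∃ λ c → c ⊆ others × length c ≡ suc q × AllPairs P c) ⊎
           (∃ λ c → c ⊆ others × length c ≡ suc r × AllPairs (λ x y → S x y × ¬ P x y) c) → Goal
  extend (inj₁ (x ∷ c , c⊆ , len , h ∷ Pc))
    with y , y∈l , Pyx ← find (proj₂ (∈-filter⁻ hasPred? {xs = l} (c⊆ (here refl)))) =
    inj₁ (y ∷ x ∷ c , ∈-∷⁺ʳ y∈l (⊆-trans c⊆ (filter-⊆ hasPred? l)) , cong suc len ,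
          (Pyx ∷ All.map (P-trans Pyx) h) ∷ h ∷ Pc)
  extend (inj₂ (c , c⊆ , rest)) = inj₂ (c , ⊆-trans c⊆ (filter-⊆ hasPred? l) , rest)
  split : r <ℕ length minimal ⊎ length minimal ≤ℕ r → Goal
  split (inj₁ r<) = inj₂ (take (suc r) minimal ,
    ⊆-trans (take-⊆ (suc r) minimal) (filter-⊆ (¬? ∘ hasPred?) l) ,
    trans (length-take (suc r) minimal) (ℕ.m≤n⇒m⊓n≡m r<) ,
    AllPairs.take⁺ (suc r) antichain)
  split (inj₂ ≤r) = extend (chain-or-antichain P? P-trans q r others (AllPairs.filter⁺ hasPred? Sl)
    (ℕ.+-cancelˡ-< r _ _ (begin-strict
      r +ℕ q *ℕ r                       <⟨ long ⟩
      length l                          ≡⟨ length-filter-split hasPred? l ⟨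
      length minimal +ℕ length others   ≤⟨ ℕ.+-monoˡ-≤ _ ≤r ⟩
      r +ℕ length others                ∎)))
    where open ℕ.≤-Reasoning

Increasing Decreasing : {A : Set} → (A → ℕ) → List A → Set
Increasing ρ = AllPairs (_<ℕ_ on ρ)
Decreasing ρ = AllPairs (λ x y → ρ y <ℕ ρ x)

-- Each ranking costs a square root of the length. A chain for `Up` is increasing in the first
-- ranking; an antichain is decreasing, because `S`-related elements are distinct and so have
-- distinct ranks. `S` is arbitrary so that the recursive call can run with `Up` or `Down` in its
-- place: its result then stays monotone in the rankings already treated.
erdős–szekeres : {A : Set} (q k : ℕ) (ρ : Fin k → A → ℕ) → (∀ i {x y} → ρ i x ≡ ρ i y → x ≡ y) →
  {S : Rel A 0ℓ} → Decidable S → Transitive S → (∀ {x y} → S x y → x ≢ y) →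
  (l : List A) → AllPairs S l → q ^ℕ (2 ^ℕ k) <ℕ length l →
  ∃ λ c → c ⊆ l × length c ≡ suc q × AllPairs S c × (∀ i → Increasing (ρ i) c ⊎ Decreasing (ρ i) c)
-- Here `2 ^ℕ 0` is 1, so `l` has more than `q` elements and its first `suc q` serve.
erdős–szekeres q zero ρ ρ-inj S? S-trans S-irr l Sl long =
  take (suc q) l , take-⊆ (suc q) l ,
  trans (length-take (suc q) l) (ℕ.m≤n⇒m⊓n≡m (subst (_<ℕ length l) (ℕ.^-identityʳ q) long)) ,
  AllPairs.take⁺ (suc q) Sl , λ ()
erdős–szekeres {A} q (suc k) ρ ρ-inj {S} S? S-trans S-irr l Sl long =
  [ (λ (c , c⊆ , len , Uc) → refine (inj₁ ∘ AllPairs.map proj₂) Up? Up-trans proj₁ c c⊆ len Uc)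
  , (λ (c , c⊆ , len , Dc) → refine (inj₂ ∘ AllPairs.map proj₂) Down? Down-trans proj₁ c c⊆ len
      (AllPairs.map down Dc))
  ]′ (chain-or-antichain Up? Up-trans Q Q l Sl (subst (_<ℕ length l) Q² long))
  where
  ρ₀ : A → ℕ
  ρ₀ = ρ zero
  Q : ℕ
  Q = q ^ℕ (2 ^ℕ k)
  Q² : q ^ℕ (2 ^ℕ suc k) ≡ Q *ℕ Q
  Q² = trans (cong (λ e → q ^ℕ (2 ^ℕ k +ℕ e)) (ℕ.+-identityʳ (2 ^ℕ k))) (ℕ.^-distribˡ-+-* q (2 ^ℕ k) (2 ^ℕ k))
  Up Down : Rel A 0ℓ
  Up x y = S x y × ρ₀ x <ℕ ρ₀ y
  Down x y = S x y × ρ₀ y <ℕ ρ₀ x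
  Up? : Decidable Up
  Up? x y = S? x y ×-dec (ρ₀ x ℕ.<? ρ₀ y)
  Down? : Decidable Down
  Down? x y = S? x y ×-dec (ρ₀ y ℕ.<? ρ₀ x)
  Up-trans : Transitive Up
  Up-trans (s , u) (s′ , u′) = S-trans s s′ , ℕ.<-trans u u′
  Down-trans : Transitive Down
  Down-trans (s , u) (s′ , u′) = S-trans s s′ , ℕ.<-trans u′ u
  down : ∀ {x y} → S x y × ¬ Up x y → Down x y
  down {x} {y} (s , ¬up) with ℕ.<-cmp (ρ₀ x) (ρ₀ y)
  ... | tri< lt _ _ = contradiction (s , lt) ¬up
  ... | tri≈ _ eq _ = contradiction (ρ-inj zero eq) (S-irr s)
  ... | tri> _ _ gt = s , gt
  refine : {T : Rel A 0ℓ} →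
    (∀ {c} → AllPairs T c → Increasing ρ₀ c ⊎ Decreasing ρ₀ c) →
    Decidable T → Transitive T → (∀ {x y} → T x y → S x y) →
    ∀ c → c ⊆ l → length c ≡ suc Q → AllPairs T c →
    ∃ λ c → c ⊆ l × length c ≡ suc q × AllPairs S c × (∀ i → Increasing (ρ i) c ⊎ Decreasing (ρ i) c)
  refine mono T? T-trans T⇒S c c⊆l len Tc
    with c′ , c′⊆c , len′ , Tc′ , mono′ ←
      erdős–szekeres q k (ρ ∘ suc) (ρ-inj ∘ suc) T? T-trans (S-irr ∘ T⇒S) c Tc (ℕ.≤-reflexive (sym len)) =
    c′ , ⊆-trans c′⊆c c⊆l , len′ , AllPairs.map T⇒S Tc′ , λ { zero → mono Tc′ ; (suc i) → mono′ i }

-- Rows and forced choices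

-- A row lists the neighbours of an A-vertex, starting with its partner in the perfect matching.
Row : Set → Set
Row A = A × List A

neighbours : {A : Set} → Row A → List A
neighbours (p , bs) = p ∷ bs

partners : {A : Set} → List (Row A) → List A
partners = map proj₁

-- The minimum is over all neighbours, taken or not. As `Forced` asks for distinct picks, each one
-- is still free when its row arrives, provided these rows come first.
Picks : {A : Set} → (A → ℕ) → Row A → A → Set
Picks ρ row z = z ∈ neighbours row × (∀ {b} → b ∈ neighbours row → ρ z ≤ℕ ρ b)

-- The inclusion `zs ⊆ l` keeps the picks of different gadgets apart when their row lists are
-- concatenated.
Forced : {A : Set} → (A → ℕ) → List A → List (Row A) → Set
Forced ρ l rows =
  ∃ λ zs → Pointwise (Picks ρ) rows zs × zs ⊆ l × Unique zs × Disjoint zs (partners rows)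

-- Under each ranking ρ i, vertices with these rows arriving first never take a partner.
record Forcing {A : Set} {k : ℕ} (ρ : Fin k → A → ℕ) (l : List A) (rows : List (Row A)) : Set where
  field
    partners-⊆      : partners rows ⊆ l
    partners-unique : Unique (partners rows)
    forced          : ∀ i → Forced (ρ i) l rows

disjoint-⊆ : {A : Set} {xs ys xs′ ys′ : List A} → xs ⊆ xs′ → ys ⊆ ys′ → Disjoint xs′ ys′ → Disjoint xs ys
disjoint-⊆ xs⊆ ys⊆ dis (v∈xs , v∈ys) = dis (xs⊆ v∈xs , ys⊆ v∈ys)

disjoint-++ : {A : Set} {xs ys us vs l l′ : List A} → xs ⊆ l → us ⊆ l → ys ⊆ l′ → vs ⊆ l′ →
  Disjoint l l′ → Disjoint xs us → Disjoint ys vs → Disjoint (xs ++ ys) (us ++ vs)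
disjoint-++ {xs = xs} {us = us} xs⊆ us⊆ ys⊆ vs⊆ l#l′ xs#us ys#vs (v∈ , v∈′)
  with ∈-++⁻ xs v∈ | ∈-++⁻ us v∈′
... | inj₁ v∈xs | inj₁ v∈us = xs#us (v∈xs , v∈us)
... | inj₁ v∈xs | inj₂ v∈vs = l#l′ (xs⊆ v∈xs , vs⊆ v∈vs)
... | inj₂ v∈ys | inj₁ v∈us = l#l′ (us⊆ v∈us , ys⊆ v∈ys)
... | inj₂ v∈ys | inj₂ v∈vs = ys#vs (v∈ys , v∈vs)

++-⊆ : {A : Set} {xs ys l : List A} → xs ⊆ l → ys ⊆ l → xs ++ ys ⊆ l
++-⊆ {xs = xs} xs⊆ ys⊆ v∈ = [ xs⊆ , ys⊆ ]′ (∈-++⁻ xs v∈)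

-- Picks and partners of each part stay inside its own vertex list, so gadgets on disjoint lists do
-- not interact.
forcing-++ : {A : Set} {k : ℕ} {ρ : Fin k → A → ℕ} {l₁ l₂ l : List A} {rows₁ rows₂ : List (Row A)} →
  l₁ ⊆ l → l₂ ⊆ l → Disjoint l₁ l₂ →
  Forcing ρ l₁ rows₁ → Forcing ρ l₂ rows₂ → Forcing ρ l (rows₁ ++ rows₂)
forcing-++ {ρ = ρ} {l = l} {rows₁ = rows₁} {rows₂ = rows₂} l₁⊆ l₂⊆ l₁#l₂ F₁ F₂ = record
  { partners-⊆ = subst (_⊆ l) (sym partners-++) (++-⊆ (⊆-trans F₁.partners-⊆ l₁⊆) (⊆-trans F₂.partners-⊆ l₂⊆))
  ; partners-unique = subst Unique (sym partners-++)
      (Unique.++⁺ F₁.partners-unique F₂.partners-unique (disjoint-⊆ F₁.partners-⊆ F₂.partners-⊆ l₁#l₂))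
  ; forced = forced
  }
  where
  module F₁ = Forcing F₁
  module F₂ = Forcing F₂
  partners-++ : partners (rows₁ ++ rows₂) ≡ partners rows₁ ++ partners rows₂
  partners-++ = map-++ proj₁ rows₁ rows₂
  forced : ∀ i → Forced (ρ i) l (rows₁ ++ rows₂)
  forced i with zs₁ , picks₁ , zs₁⊆ , u₁ , dis₁ ← F₁.forced i
              | zs₂ , picks₂ , zs₂⊆ , u₂ , dis₂ ← F₂.forced i =
    zs₁ ++ zs₂ , Pointwise.++⁺ picks₁ picks₂ ,
    ++-⊆ (⊆-trans zs₁⊆ l₁⊆) (⊆-trans zs₂⊆ l₂⊆) ,
    Unique.++⁺ u₁ u₂ (disjoint-⊆ zs₁⊆ zs₂⊆ l₁#l₂) ,
    subst (Disjoint (zs₁ ++ zs₂)) (sym partners-++)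
      (disjoint-++ zs₁⊆ F₁.partners-⊆ zs₂⊆ F₂.partners-⊆ l₁#l₂ dis₁ dis₂)

-- The gadget on a monotone sequence

-- Recursing on `y ∷ c` makes consecutive rows share `y`, so that `m` rows occupy only `2m + 1`
-- vertices.
gadget : {A : Set} → List A → List (Row A)
gadget (x ∷ p ∷ y ∷ c) = (p , x ∷ y ∷ []) ∷ gadget (y ∷ c)
gadget _ = []

lefts : {A : Set} → List A → List A
lefts (x ∷ p ∷ y ∷ c) = x ∷ lefts (y ∷ c)
lefts _ = []

rights : {A : Set} → List A → List A
rights (x ∷ p ∷ y ∷ c) = y ∷ rights (y ∷ c)
rights _ = []

length-gadget : {A : Set} (m : ℕ) (c : List A) → length c ≡ suc (m +ℕ m) → length (gadget c) ≡ m
length-gadget zero (x ∷ []) _ = refl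
length-gadget (suc m) (x ∷ p ∷ []) eq with () ← trans (ℕ.suc-injective (ℕ.suc-injective eq)) (ℕ.+-suc m m)
length-gadget (suc m) (x ∷ p ∷ y ∷ c) eq =
  cong suc (length-gadget m (y ∷ c) (trans (ℕ.suc-injective (ℕ.suc-injective eq)) (ℕ.+-suc m m)))
length-gadget (suc m) (x ∷ []) ()

-- The head is left out of the bound: it is shared with the preceding row, which may pick it, so it
-- has to differ from all later partners.
partners-gadget-⊆ : {A : Set} (x : A) (c : List A) → partners (gadget (x ∷ c)) ⊆ c
partners-gadget-⊆ x (p ∷ y ∷ c) (here refl) = here refl
partners-gadget-⊆ x (p ∷ y ∷ c) (there v∈) = there (there (partners-gadget-⊆ y c v∈))

lefts-⊆ : {A : Set} (c : List A) → lefts c ⊆ c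
lefts-⊆ (x ∷ p ∷ y ∷ c) (here refl) = here refl
lefts-⊆ (x ∷ p ∷ y ∷ c) (there v∈) = there (there (lefts-⊆ (y ∷ c) v∈))

-- Again the head is left out, since it may already be the pick of the preceding row.
rights-⊆ : {A : Set} (x : A) (c : List A) → rights (x ∷ c) ⊆ c
rights-⊆ x (p ∷ y ∷ c) (here refl) = there (here refl)
rights-⊆ x (p ∷ y ∷ c) (there v∈) = there (there (rights-⊆ y c v∈))

disjoint-∷ : {A : Set} {z p : A} {zs ps : List A} →
  z ≢ p → All (z ≢_) ps → All (p ≢_) zs → Disjoint zs ps → Disjoint (z ∷ zs) (p ∷ ps)
disjoint-∷ z≢p z∉ p∉ dis (here refl , here eq) = z≢p eq
disjoint-∷ z≢p z∉ p∉ dis (here refl , there v∈) = All.lookup z∉ v∈ refl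
disjoint-∷ z≢p z∉ p∉ dis (there v∈ , here refl) = All.lookup p∉ v∈ refl
disjoint-∷ z≢p z∉ p∉ dis (there v∈ , there v∈′) = dis (v∈ , v∈′)

partners-gadget-unique : {A : Set} {c : List A} → Unique c → Unique (partners (gadget c))
partners-gadget-unique {c = []} _ = []
partners-gadget-unique {c = x ∷ []} _ = []
partners-gadget-unique {c = x ∷ p ∷ []} _ = []
partners-gadget-unique {c = x ∷ p ∷ y ∷ c} (_ ∷ (_ ∷ p∉c) ∷ u) =
  anti-mono (partners-gadget-⊆ y c) p∉c ∷ partners-gadget-unique u

increasing⇒forced : {A : Set} {ρ : A → ℕ} {c : List A} → Unique c → Increasing ρ c → Forced ρ c (gadget c)
increasing⇒forced {ρ = ρ} {c} u inc = lefts c , picks c inc , lefts-⊆ c , unique u , disjoint u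
  where
  picks : ∀ c → Increasing ρ c → Pointwise (Picks ρ) (gadget c) (lefts c)
  picks [] _ = []
  picks (x ∷ []) _ = []
  picks (x ∷ p ∷ []) _ = []
  picks (x ∷ p ∷ y ∷ c) ((x<p ∷ x<y ∷ _) ∷ _ ∷ inc) =
    (there (here refl) , λ { (here refl) → ℕ.<⇒≤ x<p ; (there (here refl)) → ℕ.≤-refl
                           ; (there (there (here refl))) → ℕ.<⇒≤ x<y }) ∷ picks (y ∷ c) inc
  unique : ∀ {c} → Unique c → Unique (lefts c)
  unique {[]} _ = []
  unique {x ∷ []} _ = []
  unique {x ∷ p ∷ []} _ = []
  unique {x ∷ p ∷ y ∷ c} ((_ ∷ x∉) ∷ _ ∷ u) = anti-mono (lefts-⊆ (y ∷ c)) x∉ ∷ unique u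
  disjoint : ∀ {c} → Unique c → Disjoint (lefts c) (partners (gadget c))
  disjoint {x ∷ p ∷ y ∷ c} ((x≢p ∷ _ ∷ x∉c) ∷ p∉ ∷ u) =
    disjoint-∷ x≢p (anti-mono (partners-gadget-⊆ y c) x∉c) (anti-mono (lefts-⊆ (y ∷ c)) p∉) (disjoint u)
  disjoint {[]} _ ()
  disjoint {x ∷ []} _ ()
  disjoint {x ∷ p ∷ []} _ ()

-- A shared vertex is picked by the earlier of its two rows here, and by the later one in the
-- increasing case. Either way it is picked once.
decreasing⇒forced : {A : Set} {ρ : A → ℕ} {c : List A} → Unique c → Decreasing ρ c → Forced ρ c (gadget c)
decreasing⇒forced {ρ = ρ} {c} u dec = rights c , picks c dec , rights-⊆′ c , unique u , disjoint u
  where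
  rights-⊆′ : ∀ c → rights c ⊆ c
  rights-⊆′ (x ∷ c) v∈ = there (rights-⊆ x c v∈)
  picks : ∀ c → Decreasing ρ c → Pointwise (Picks ρ) (gadget c) (rights c)
  picks [] _ = []
  picks (x ∷ []) _ = []
  picks (x ∷ p ∷ []) _ = []
  picks (x ∷ p ∷ y ∷ c) ((_ ∷ y<x ∷ _) ∷ (y<p ∷ _) ∷ dec) =
    (there (there (here refl)) , λ { (here refl) → ℕ.<⇒≤ y<p ; (there (here refl)) → ℕ.<⇒≤ y<x
                                   ; (there (there (here refl))) → ℕ.≤-refl }) ∷ picks (y ∷ c) dec
  unique : ∀ {c} → Unique c → Unique (rights c)
  unique {[]} _ = []
  unique {x ∷ []} _ = []
  unique {x ∷ p ∷ []} _ = []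
  unique {x ∷ p ∷ y ∷ c} (_ ∷ _ ∷ u@(y∉ ∷ _)) = anti-mono (rights-⊆ y c) y∉ ∷ unique u
  disjoint : ∀ {c} → Unique c → Disjoint (rights c) (partners (gadget c))
  disjoint {x ∷ p ∷ y ∷ c} (_ ∷ (p≢y ∷ p∉c) ∷ u@(y∉ ∷ _)) =
    disjoint-∷ (p≢y ∘ sym) (anti-mono (partners-gadget-⊆ y c) y∉) (anti-mono (rights-⊆ y c) p∉c) (disjoint u)
  disjoint {[]} _ ()
  disjoint {x ∷ []} _ ()
  disjoint {x ∷ p ∷ []} _ ()

gadget-forcing : {A : Set} {k : ℕ} {ρ : Fin k → A → ℕ} {c : List A} → Unique c →
  (∀ i → Increasing (ρ i) c ⊎ Decreasing (ρ i) c) → Forcing ρ c (gadget c)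
gadget-forcing {c = c} u mono = record
  { partners-⊆ = ⊆c c
  ; partners-unique = partners-gadget-unique u
  ; forced = λ i → [ increasing⇒forced u , decreasing⇒forced u ]′ (mono i)
  }
  where
  ⊆c : ∀ c → partners (gadget c) ⊆ c
  ⊆c (x ∷ c) v∈ = there (partners-gadget-⊆ x c v∈)

-- Extracting monotone sequences from B

module _ {n : ℕ} where

  open import Data.List.Membership.DecPropositional (_≟_ {n}) using (_∈?_; _∉?_)

  -- Greedy extraction: while more than `(2m)^(2^k)` vertices remain, a monotone sequence of
  -- `2m + 1` of them is removed and yields `m` rows. The order of `Fin n` serves as the initial
  -- relation `S`; it passes to filtered lists and guarantees distinctness. `N` bounds the length
  -- and makes the recursion structural.
  extract : (m k : ℕ) (ρ : Fin k → Fin n → ℕ) → (∀ i {x y} → ρ i x ≡ ρ i y → x ≡ y) →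
    ∀ N (l : List (Fin n)) → length l ≤ℕ N → AllPairs Data.Fin._<_ l →
    ∃ λ rows → Forcing ρ l rows × ∃ λ g → length rows ≡ g *ℕ m ×
      length l ≤ℕ g *ℕ suc (m +ℕ m) +ℕ (m +ℕ m) ^ℕ (2 ^ℕ k)
  extract m k ρ ρ-inj N l l≤N l↑ with ℕ.<-≤-connex ((m +ℕ m) ^ℕ (2 ^ℕ k)) (length l)
  ... | inj₂ short = [] ,
    record { partners-⊆ = λ () ; partners-unique = []
           ; forced = λ i → [] , [] , (λ ()) , [] , λ { (() , _) } } ,
    0 , refl , short
  extract m k ρ ρ-inj zero [] l≤N l↑ | inj₁ ()
  extract m k ρ ρ-inj (suc N) l l≤N l↑ | inj₁ long
    with erdős–szekeres (m +ℕ m) k ρ ρ-inj Fin._<?_ Fin.<-trans (λ lt → Fin.<⇒≢ lt) l l↑ long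
  ... | c@(x ∷ _) , c⊆l , len-c , c↑ , mono
    with rows , F , g , len-rows , bound ←
      extract m k ρ ρ-inj N (filter (_∉? c) l)
        -- The head of `c` lies in `l` and is filtered out, so the remaining list is strictly
        -- shorter.
        (s≤s⁻¹ (ℕ.≤-trans (filter-notAll (_∉? c) l (lose (c⊆l (here refl)) λ x∉c → x∉c (here refl))) l≤N))
        (AllPairs.filter⁺ (_∉? c) l↑) =
    gadget c ++ rows ,
    forcing-++ c⊆l (filter-⊆ (_∉? c) l) (λ (v∈c , v∈) → proj₂ (∈-filter⁻ (_∉? c) {xs = l} v∈) v∈c)
      (gadget-forcing (AllPairs.map Fin.<⇒≢ c↑) mono) F ,
    suc g ,
    trans (length-++ (gadget c)) (cong₂ _+ℕ_ (length-gadget m c len-c) len-rows) ,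
    (begin
      length l                              ≤⟨ unique-⊆⇒length≤ (AllPairs.map Fin.<⇒≢ l↑) l⊆ ⟩
      length (c ++ filter (_∉? c) l)        ≡⟨ length-++ c ⟩
      length c +ℕ length (filter (_∉? c) l) ≤⟨ ℕ.+-mono-≤ (ℕ.≤-reflexive len-c) bound ⟩
      s +ℕ (g *ℕ s +ℕ _)                    ≡⟨ ℕ.+-assoc s (g *ℕ s) _ ⟨
      suc g *ℕ s +ℕ _                       ∎)
    where
    open ℕ.≤-Reasoning
    s : ℕ
    s = suc (m +ℕ m)
    l⊆ : l ⊆ c ++ filter (_∉? c) l
    l⊆ {v} v∈ with v ∈? c
    ... | yes v∈c = ∈-++⁺ˡ v∈c
    ... | no v∉c = ∈-++⁺ʳ c (∈-filter⁺ (_∉? c) v∈ v∉c)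

  -- Behaviour of Ranking

  rank : Permutation′ n → Fin n → ℕ
  rank σ b = toℕ (σ ⟨$⟩ʳ b)

  rank-injective : (σ : Permutation′ n) {x y : Fin n} → rank σ x ≡ rank σ y → x ≡ y
  rank-injective σ eq = trans (sym (inverseˡ σ)) (trans (cong (σ ⟨$⟩ˡ_) (Fin.toℕ-injective eq)) (inverseˡ σ))

  byRank-increasing : (σ : Permutation′ n) → Increasing (rank σ) (byRank σ)
  byRank-increasing σ = AllPairs.map⁺ (AllPairs.tabulate⁺-<
    λ i<j → subst₂ _<ℕ_ (cong toℕ (sym (inverseʳ σ))) (cong toℕ (sym (inverseʳ σ))) i<j)

  ∈-byRank : (σ : Permutation′ n) (b : Fin n) → b ∈ byRank σ
  ∈-byRank σ b = subst (_∈ byRank σ) (inverseˡ σ) (∈-map⁺ (σ ⟨$⟩ˡ_) (∈-allFin (σ ⟨$⟩ʳ b)))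

  firstFree-sound : (G : BipGraph n) (used : Fin n → Bool) (a : Fin n) (l : List (Fin n)) {b : Fin n} →
    firstFree G used a l ≡ just b → G a b ≡ true × used b ≡ false
  firstFree-sound G used a (b ∷ l) eq with G a b in Gab | used b in free
  firstFree-sound G used a (b ∷ l) refl | true  | false = Gab , free
  firstFree-sound G used a (b ∷ l) eq   | true  | true  = firstFree-sound G used a l eq
  firstFree-sound G used a (b ∷ l) eq   | false | _     = firstFree-sound G used a l eq

  -- Whatever precedes `z` in the sorted list has smaller rank, hence is no neighbour of `a`, and
  -- the search passes over it.
  firstFree-least : (G : BipGraph n) (used : Fin n → Bool) (ρ : Fin n → ℕ) {a z : Fin n} {l : List (Fin n)} →
    Increasing ρ l → z ∈ l → G a z ≡ true → used z ≡ false → (∀ {b} → G a b ≡ true → ρ z ≤ℕ ρ b) →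
    firstFree G used a l ≡ just z
  firstFree-least G used ρ l↑ (here refl) Gaz free least rewrite Gaz | free = refl
  firstFree-least G used ρ {a} {l = b ∷ l} (b<l ∷ l↑) (there z∈) Gaz free least with G a b in Gab
  ... | true = contradiction (least Gab) (ℕ.<⇒≱ (All.lookup b<l z∈))
  ... | false = firstFree-least G used ρ l↑ z∈ Gaz free least

  markMatched-free⁻ : (used : Fin n → Bool) {b b′ : Fin n} → markMatched used b b′ ≡ false → b ≢ b′ × used b′ ≡ false
  markMatched-free⁻ used {b} {b′} eq with b′ ≟ b
  ... | no b′≢b = b′≢b ∘ sym , eq

  markMatched-free⁺ : (used : Fin n → Bool) {b b′ : Fin n} → b ≢ b′ → used b′ ≡ false → markMatched used b b′ ≡ false
  markMatched-free⁺ used {b} {b′} b≢b′ free with b′ ≟ b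
  ... | yes b′≡b = contradiction (sym b′≡b) b≢b′
  ... | no _ = free

  matched : BipGraph n → Permutation′ n → (Fin n → Bool) → List (Fin n) → List (Fin n)
  matched G σ used as = map proj₂ (rankingGo G σ used as)

  -- The second component carries the induction: applied after `b` is marked, it says that every
  -- later match differs from `b`.
  matched-unique : (G : BipGraph n) (σ : Permutation′ n) (used : Fin n → Bool) (as : List (Fin n)) →
    Unique (matched G σ used as) × All (λ b → used b ≡ false) (matched G σ used as)
  matched-unique G σ used [] = [] , []
  matched-unique G σ used (a ∷ as) with firstFree G used a (byRank σ) in eq
  ... | nothing = matched-unique G σ used as
  ... | just b with u , free ← matched-unique G σ (markMatched used b) as =
    (All.map (proj₁ ∘ markMatched-free⁻ used) free ∷ u) ,
    (proj₂ (firstFree-sound G used a (byRank σ) eq) ∷ All.map (proj₂ ∘ markMatched-free⁻ used) free)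

  matched-adjacent : (G : BipGraph n) (σ : Permutation′ n) (used : Fin n → Bool) (as : List (Fin n)) {b : Fin n} →
    b ∈ matched G σ used as → ∃ λ a → a ∈ as × G a b ≡ true
  matched-adjacent G σ used (a ∷ as) b∈ with firstFree G used a (byRank σ) in eq
  matched-adjacent G σ used (a ∷ as) b∈ | nothing
    with a′ , a′∈ , Ga′b ← matched-adjacent G σ used as b∈ = a′ , there a′∈ , Ga′b
  matched-adjacent G σ used (a ∷ as) (here refl) | just b =
    a , here refl , proj₁ (firstFree-sound G used a (byRank σ) eq)
  matched-adjacent G σ used (a ∷ as) (there b∈) | just b
    with a′ , a′∈ , Ga′b ← matched-adjacent G σ (markMatched used b) as b∈ = a′ , there a′∈ , Ga′b

  -- By distinctness no pick is used up by an earlier one, so the vertices of `as` take exactly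
  -- `zs`. Of the later arrivals only adjacency is recorded.
  matched-forced : (G : BipGraph n) (σ : Permutation′ n) (used : Fin n → Bool) {as as′ zs : List (Fin n)} →
    Pointwise (λ a z → G a z ≡ true × (∀ {b} → G a b ≡ true → rank σ z ≤ℕ rank σ b)) as zs →
    Unique zs → All (λ z → used z ≡ false) zs → {b : Fin n} → b ∈ matched G σ used (as ++ as′) →
    b ∈ zs ⊎ ∃ λ a → a ∈ as′ × G a b ≡ true
  matched-forced G σ used {as′ = as′} [] _ _ b∈ = inj₂ (matched-adjacent G σ used as′ b∈)
  matched-forced G σ used ((Gaz , least) ∷ picks) (z∉ ∷ u) (free ∷ frees) b∈
    rewrite firstFree-least G used (rank σ) (byRank-increasing σ) (∈-byRank σ _) Gaz free least with b∈
  ... | here refl = inj₁ (here refl)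
  ... | there b∈′ = [ inj₁ ∘ there , inj₂ ]′ (matched-forced G σ _ picks u
          (All.zipWith (λ (z≢ , f) → markMatched-free⁺ used z≢ f) (z∉ , frees)) b∈′)

  -- The graph given by a list of rows

  does⁻ : {P : Set} (P? : Dec P) → does P? ≡ true → P
  does⁻ (yes p) _ = p

  length-enumeration : {l : List (Fin n)} → Unique l → (∀ b → b ∈ l) → n ≡ length l
  length-enumeration {l} u all∈ = ℕ.≤-antisym
    (subst (_≤ℕ length l) (length-tabulate id) (unique-⊆⇒length≤ (Unique.allFin⁺ n) (λ {b} _ → all∈ b)))
    (subst (length l ≤ℕ_) (length-tabulate id) (unique-⊆⇒length≤ u (λ {b} _ → ∈-allFin b)))

  -- Rows are dealt out by arrival position, so the first rows of the list belong to the first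
  -- arrivals whatever `π` is. Listing each vertex of B once as a partner makes the number of rows
  -- equal to `n`.
  module RowGraph (π : Permutation′ n) (rows : List (Row (Fin n)))
                  (unique : Unique (partners rows)) (complete : ∀ b → b ∈ partners rows) where

    n≡ : n ≡ length rows
    n≡ = trans (length-enumeration unique complete) (length-map proj₁ rows)

    row : Fin n → Row (Fin n)
    row a = lookup rows (cast n≡ (π ⟨$⟩ʳ a))

    graph : BipGraph n
    graph a b = does (b ∈? neighbours (row a))

    arrivals : List (Fin n)
    arrivals = map (π ⟨$⟩ˡ_) (allFin n)

    rows-arrivals : map row arrivals ≡ rows
    rows-arrivals = begin
      map row arrivals                     ≡⟨ cong (map row) (map-tabulate id (π ⟨$⟩ˡ_)) ⟩
      map row (tabulate (π ⟨$⟩ˡ_))         ≡⟨ map-tabulate (π ⟨$⟩ˡ_) row ⟩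
      tabulate (row ∘ (π ⟨$⟩ˡ_))           ≡⟨ tabulate-cong (λ _ → cong (lookup rows ∘ cast n≡) (inverseʳ π)) ⟩
      tabulate (lookup rows ∘ cast n≡)     ≡⟨ tabulate-lookup-cast rows n≡ ⟩
      rows                                 ∎
      where open ≡-Reasoning

    partners-arrivals : map (proj₁ ∘ row) arrivals ≡ partners rows
    partners-arrivals = trans (map-∘ arrivals) (cong partners rows-arrivals)

    -- The inverse of `proj₁ ∘ row` is found by looking up `b` among the partners of the arrivals:
    -- completeness makes the lookup succeed, uniqueness makes the result the only preimage.
    perfectMatching : HasPerfectMatching graph
    perfectMatching =
      permutation (proj₁ ∘ row) (proj₁ ∘ source)
        (λ b → sym (proj₂ (proj₂ (source b))))
        (λ a → unique-map⇒injective (proj₁ ∘ row) (subst Unique (sym partners-arrivals) unique)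
          (∈-byRank π _) (∈-byRank π _) (sym (proj₂ (proj₂ (source (proj₁ (row a))))))) ,
      λ a → dec-true (_ ∈? neighbours (row a)) (here refl)
      where
      source : ∀ b → ∃ λ a → a ∈ arrivals × b ≡ proj₁ (row a)
      source b = ∈-map⁻ (proj₁ ∘ row) (subst (b ∈_) (sym partners-arrivals) (complete b))

  -- Size of the matchings in the adversarial graph

  length-Ranking≤n : (G : BipGraph n) (π σ : Permutation′ n) → length (Ranking G π σ) ≤ℕ n
  length-Ranking≤n G π σ = subst₂ _≤ℕ_ (length-map proj₂ (Ranking G π σ)) (length-tabulate id)
    (unique-⊆⇒length≤ (proj₁ (matched-unique G σ (λ _ → false) (map (π ⟨$⟩ˡ_) (allFin n)))) (λ {b} _ → ∈-allFin b))

  -- No gadget partner is ever matched: the first arrivals take their forced picks, and each later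
  -- one is adjacent to a single vertex of `free`. The matched vertices and the `g * m` partners are
  -- therefore disjoint subsets of B.
  adversarial-graph : (m k : ℕ) (σ : Fin k → Permutation′ n) (π : Permutation′ n) →
    Σ (BipGraph n) λ G → HasPerfectMatching G × ∃ λ g →
      n ≤ℕ g *ℕ suc (m +ℕ m) +ℕ (m +ℕ m) ^ℕ (2 ^ℕ k) ×
      (∀ i → length (Ranking G π (σ i)) +ℕ g *ℕ m ≤ℕ n)
  adversarial-graph m k σ π
    with rows , F , g , len-rows , bound ←
      extract m k (rank ∘ σ) (rank-injective ∘ σ) n (allFin n)
        (ℕ.≤-reflexive (length-tabulate id)) (AllPairs.tabulate⁺-< id) =
    graph , perfectMatching , g , subst (_≤ℕ _) (length-tabulate id) bound , matched-bound
    where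
    open Forcing F
    ps free : List (Fin n)
    ps = partners rows
    -- This contains the non-partner vertices of the sequences as well as the vertices outside all
    -- sequences.
    free = filter (_∉? ps) (allFin n)
    single : Fin n → Row (Fin n)
    single b = b , []
    partners-all : partners (rows ++ map single free) ≡ ps ++ free
    partners-all = trans (map-++ proj₁ rows (map single free))
      (cong (ps ++_) (trans (sym (map-∘ free)) (map-id free)))
    free-∉ : ∀ {b} → b ∈ free → b ∉ ps
    free-∉ b∈ = proj₂ (∈-filter⁻ (_∉? ps) {xs = allFin n} b∈)
    complete : ∀ b → b ∈ ps ++ free
    complete b with b ∈? ps
    ... | yes b∈ = ∈-++⁺ˡ b∈
    ... | no b∉ = ∈-++⁺ʳ ps (∈-filter⁺ (_∉? ps) (∈-allFin b) b∉)
    open RowGraph π (rows ++ map single free)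
      (subst Unique (sym partners-all)
        (Unique.++⁺ partners-unique (Unique.filter⁺ (_∉? ps) (Unique.allFin⁺ n)) λ (b∈ , b∈′) → free-∉ b∈′ b∈))
      (λ b → subst (b ∈_) (sym partners-all) (complete b))

    matched-∉ : ∀ i {b} → b ∈ matched graph (σ i) (λ _ → false) arrivals → b ∉ ps
    matched-∉ i {b} b∈ b∈ps
      -- The arrivals are cut where the gadget rows end: `as` carries `rows`, and `as′` carries the
      -- single-neighbour rows.
      with as , as′ , split , rows≡ , singles≡ ← map-++⁻ row arrivals rows rows-arrivals
         | zs , picks , _ , u , dis ← forced i
      with matched-forced graph (σ i) (λ _ → false)
             (Pointwise.map (λ (z∈ , least) → dec-true (_ ∈? _) z∈ , λ Gab → least (does⁻ (_ ∈? _) Gab))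
               (Pointwise.map⁻ row id (subst₂ (Pointwise (Picks (rank (σ i)))) (sym rows≡) (sym (map-id zs)) picks)))
             u (All.universal (λ _ → refl) zs)
             (subst (λ l → b ∈ matched graph (σ i) (λ _ → false) l) split b∈)
    ... | inj₁ b∈zs = dis (b∈zs , b∈ps)
    ... | inj₂ (a , a∈ , Gab)
      with b′ , b′∈ , eq ← ∈-map⁻ single (subst (row a ∈_) singles≡ (∈-map⁺ row a∈))
      with subst (λ r → b ∈ neighbours r) eq (does⁻ (b ∈? neighbours (row a)) Gab)
    ... | here refl = free-∉ b′∈ b∈ps

    matched-bound : ∀ i → length (Ranking graph π (σ i)) +ℕ g *ℕ m ≤ℕ n
    matched-bound i = begin
      length (Ranking graph π (σ i)) +ℕ g *ℕ m
        ≡⟨ cong₂ _+ℕ_ (length-map proj₂ (Ranking graph π (σ i))) (trans (length-map proj₁ rows) len-rows) ⟨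
      length bs +ℕ length ps
        ≡⟨ length-++ bs ⟨
      length (bs ++ ps)
        ≤⟨ unique-⊆⇒length≤ (Unique.++⁺ bs-unique partners-unique λ (b∈ , b∈ps) → matched-∉ i b∈ b∈ps) (λ {b} _ → ∈-allFin b) ⟩
      length (allFin n)
        ≡⟨ length-tabulate id ⟩
      n ∎
      where
      open ℕ.≤-Reasoning
      bs : List (Fin n)
      bs = matched graph (σ i) (λ _ → false) arrivals
      bs-unique : Unique bs
      bs-unique = proj₁ (matched-unique graph (σ i) (λ _ → false) arrivals)

-- Natural numbers and powers in ℚ

-- The fraction `(+ m) / 1` is normalised by a gcd that does not reduce for a variable `m`; the
-- explicit normal form lets sums, products and comparisons compute.
ℕ→ℚ-mkℚ : ∀ m → ℕ→ℚ m ≡ mkℚ (ℤ.+ m) 0 (Coprimality.sym (Coprimality.1-coprimeTo m))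
ℕ→ℚ-mkℚ m = ℚ.↥p/↧p≡p (mkℚ (ℤ.+ m) 0 (Coprimality.sym (Coprimality.1-coprimeTo m)))

ℕ→ℚ-+ : ∀ a b → ℕ→ℚ (a +ℕ b) ≡ ℕ→ℚ a + ℕ→ℚ b
ℕ→ℚ-+ a b rewrite ℕ→ℚ-mkℚ a | ℕ→ℚ-mkℚ b | ℤ.*-identityʳ (ℤ.+ a) | ℤ.*-identityʳ (ℤ.+ b) = refl

ℕ→ℚ-* : ∀ a b → ℕ→ℚ (a *ℕ b) ≡ ℕ→ℚ a * ℕ→ℚ b
ℕ→ℚ-* a b rewrite ℕ→ℚ-mkℚ a | ℕ→ℚ-mkℚ b | sym (ℤ.pos-* a b) = refl

ℕ→ℚ-mono : ∀ {a b} → a ≤ℕ b → ℕ→ℚ a ≤ ℕ→ℚ b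
ℕ→ℚ-mono {a} {b} a≤b rewrite ℕ→ℚ-mkℚ a | ℕ→ℚ-mkℚ b = *≤* (ℤ.*-monoʳ-≤-nonNeg (ℤ.+ 1) (ℤ.+≤+ a≤b))

ℕ→ℚ-nonNeg : ∀ a → NonNegative (ℕ→ℚ a)
ℕ→ℚ-nonNeg a = nonNegative (ℕ→ℚ-mono (z≤n {a}))

ℕ→ℚ-^ : ∀ a e → ℕ→ℚ (a ^ℕ e) ≡ ℕ→ℚ a ^ℚ e
ℕ→ℚ-^ a zero = refl
ℕ→ℚ-^ a (suc e) = trans (ℕ→ℚ-* a (a ^ℕ e)) (cong (ℕ→ℚ a *_) (ℕ→ℚ-^ a e))

*-mono-≤-nonNeg : ∀ {p q r s} → 0ℚ ≤ q → 0ℚ ≤ r → p ≤ q → r ≤ s → p * r ≤ q * s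
*-mono-≤-nonNeg {q = q} {r} 0≤q 0≤r p≤q r≤s = ℚ.≤-trans
  (ℚ.*-monoʳ-≤-nonNeg r {{nonNegative 0≤r}} p≤q) (ℚ.*-monoˡ-≤-nonNeg q {{nonNegative 0≤q}} r≤s)

^ℚ-positive : ∀ {p} → 0ℚ < p → ∀ e → 0ℚ < p ^ℚ e
^ℚ-positive 0<p zero = ℚ.positive⁻¹ 1ℚ
^ℚ-positive {p} 0<p (suc e) =
  ℚ.positive⁻¹ _ {{ℚ.pos*pos⇒pos p {{positive 0<p}} (p ^ℚ e) {{positive (^ℚ-positive 0<p e)}}}}

^ℚ-nonNeg : ∀ {p} → 0ℚ ≤ p → ∀ e → 0ℚ ≤ p ^ℚ e
^ℚ-nonNeg 0≤p zero = ℚ.nonNegative⁻¹ 1ℚ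
^ℚ-nonNeg {p} 0≤p (suc e) =
  ℚ.nonNegative⁻¹ _ {{ℚ.nonNeg*nonNeg⇒nonNeg p {{nonNegative 0≤p}} (p ^ℚ e) {{nonNegative (^ℚ-nonNeg 0≤p e)}}}}

^ℚ-mono : ∀ {p q} → 0ℚ ≤ p → p ≤ q → ∀ e → p ^ℚ e ≤ q ^ℚ e
^ℚ-mono 0≤p p≤q zero = ℚ.≤-refl
^ℚ-mono 0≤p p≤q (suc e) =
  *-mono-≤-nonNeg (ℚ.≤-trans 0≤p p≤q) (^ℚ-nonNeg 0≤p e) p≤q (^ℚ-mono 0≤p p≤q e)

^ℚ-antitone : ∀ {p} → 0ℚ ≤ p → p ≤ 1ℚ → ∀ {d e} → d ≤ℕ e → p ^ℚ e ≤ p ^ℚ d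
^ℚ-antitone 0≤p p≤1 {e = zero} z≤n = ℚ.≤-refl
^ℚ-antitone {p} 0≤p p≤1 {e = suc e} z≤n =
  *-mono-≤-nonNeg (ℚ.nonNegative⁻¹ 1ℚ) (^ℚ-nonNeg 0≤p e) p≤1 (^ℚ-antitone 0≤p p≤1 {e = e} z≤n)
^ℚ-antitone {p} 0≤p p≤1 (s≤s d≤e) = ℚ.*-monoˡ-≤-nonNeg p {{nonNegative 0≤p}} (^ℚ-antitone 0≤p p≤1 d≤e)

*-distrib-^ℚ : ∀ p q e → (p * q) ^ℚ e ≡ p ^ℚ e * q ^ℚ e
*-distrib-^ℚ p q zero = refl
*-distrib-^ℚ p q (suc e) = trans (cong (p * q *_) (*-distrib-^ℚ p q e))
  (solve 4 (λ p q x y → p :* q :* (x :* y) := p :* x :* (q :* y)) refl p q (p ^ℚ e) (q ^ℚ e))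
  where open ℚSolver.+-*-Solver

-- m = ⌊1/ε⌋
floor-inverse : ∀ ε → 0ℚ < ε → ∃ λ m → ℕ→ℚ m * ε ≤ 1ℚ × 1ℚ ≤ ℕ→ℚ (suc m) * ε
floor-inverse (mkℚ (ℤ.+ zero) _ _) (*<* (ℤ.+<+ ()))
floor-inverse (mkℚ ℤ.-[1+ _ ] _ _) (*<* ())
floor-inverse ε@(mkℚ (ℤ.+ u@(suc _)) v-1 _) _ = m , lower , upper
  where
  v m : ℕ
  v = suc v-1
  m = v ℕ./ u
  -- With `ε = u / v`, multiplication by `v` turns the two bounds into `m u ≤ v ≤ (m + 1) u`, which
  -- is division with remainder.
  vε≡u : ℕ→ℚ v * ε ≡ ℕ→ℚ u
  vε≡u rewrite ℕ→ℚ-mkℚ v | ℕ→ℚ-mkℚ u = ℚ.toℚᵘ-injective (ℚᵘ.≃-trans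
    (ℚ.toℚᵘ-homo-* (mkℚ (ℤ.+ v) 0 (Coprimality.sym (Coprimality.1-coprimeTo v))) ε)
    (ℚᵘ.*≡* (trans (ℤ.*-identityʳ (ℤ.+ v ℤ.* ℤ.+ u)) (trans (ℤ.*-comm (ℤ.+ v) (ℤ.+ u))
      (cong (λ d → ℤ.+ u ℤ.* ℤ.+ suc d) (sym (ℕ.+-identityʳ v-1)))))))
  v>0 : Positive (ℕ→ℚ v)
  v>0 rewrite ℕ→ℚ-mkℚ v = _
  scaled : ∀ a → ℕ→ℚ (a *ℕ u) ≡ ℕ→ℚ a * ε * ℕ→ℚ v
  scaled a = begin
    ℕ→ℚ (a *ℕ u)             ≡⟨ ℕ→ℚ-* a u ⟩
    ℕ→ℚ a * ℕ→ℚ u            ≡⟨ cong (ℕ→ℚ a *_) (trans (sym vε≡u) (ℚ.*-comm (ℕ→ℚ v) ε)) ⟩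
    ℕ→ℚ a * (ε * ℕ→ℚ v)      ≡⟨ ℚ.*-assoc (ℕ→ℚ a) ε (ℕ→ℚ v) ⟨
    ℕ→ℚ a * ε * ℕ→ℚ v        ∎
    where open ≡-Reasoning
  lower : ℕ→ℚ m * ε ≤ 1ℚ
  lower = ℚ.*-cancelʳ-≤-pos (ℕ→ℚ v) {{v>0}}
    (subst₂ _≤_ (scaled m) (sym (ℚ.*-identityˡ (ℕ→ℚ v))) (ℕ→ℚ-mono (ℕ.m/n*n≤m v u)))
  upper : 1ℚ ≤ ℕ→ℚ (suc m) * ε
  upper = ℚ.*-cancelʳ-≤-pos (ℕ→ℚ v) {{v>0}}
    (subst₂ _≤_ (sym (ℚ.*-identityˡ (ℕ→ℚ v))) (scaled (suc m)) (ℕ→ℚ-mono (begin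
      v                       ≡⟨ ℕ.m≡m%n+[m/n]*n v u ⟩
      v ℕ.% u +ℕ m *ℕ u       ≤⟨ ℕ.+-monoˡ-≤ (m *ℕ u) (ℕ.<⇒≤ (ℕ.m%n<n v u)) ⟩
      suc m *ℕ u              ∎)))
    where open ℕ.≤-Reasoning

-- Numerical estimates

-- Let `K = 2^k` and `q = 2m`, so `ε q ≤ 2`. After multiplication by `ε^K` the left side is at most
-- `2^K ≤ 2^(4K) ≤ ε^(4K) n`. Since `ε ≤ 1` and `K + 1 ≤ 4K`, this is at most `ε^K (ε n)`.
chain-threshold≤εn : ∀ {ε} m n k → 0ℚ < ε → ε ≤ 1ℚ → ℕ→ℚ m * ε ≤ 1ℚ →
  ℕ→ℚ 2 ^ℚ (2 ^ℕ (k +ℕ 2)) ≤ ε ^ℚ (2 ^ℕ (k +ℕ 2)) * ℕ→ℚ n →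
  ℕ→ℚ ((m +ℕ m) ^ℕ (2 ^ℕ k)) ≤ ε * ℕ→ℚ n
chain-threshold≤εn {ε} m n k 0<ε ε≤1 mε≤1 large = ℚ.*-cancelˡ-≤-pos (ε ^ℚ K) {{positive (^ℚ-positive 0<ε K)}} (begin
  ε ^ℚ K * ℕ→ℚ (q ^ℕ K)     ≡⟨ cong (ε ^ℚ K *_) (ℕ→ℚ-^ q K) ⟩
  ε ^ℚ K * ℕ→ℚ q ^ℚ K       ≡⟨ *-distrib-^ℚ ε (ℕ→ℚ q) K ⟨
  (ε * ℕ→ℚ q) ^ℚ K          ≤⟨ ^ℚ-mono 0≤εq εq≤2 K ⟩
  ℕ→ℚ 2 ^ℚ K                ≡⟨ ℕ→ℚ-^ 2 K ⟨
  ℕ→ℚ (2 ^ℕ K)              ≤⟨ ℕ→ℚ-mono (ℕ.^-monoʳ-≤ 2 (ℕ.≤-trans (ℕ.n≤1+n K) 1+K≤4K)) ⟩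
  ℕ→ℚ (2 ^ℕ 4K)             ≡⟨ ℕ→ℚ-^ 2 4K ⟩
  ℕ→ℚ 2 ^ℚ 4K               ≤⟨ large ⟩
  ε ^ℚ 4K * ℕ→ℚ n           ≤⟨ ℚ.*-monoʳ-≤-nonNeg (ℕ→ℚ n) {{ℕ→ℚ-nonNeg n}} (^ℚ-antitone 0≤ε ε≤1 1+K≤4K) ⟩
  ε * ε ^ℚ K * ℕ→ℚ n        ≡⟨ solve 3 (λ e p x → e :* p :* x := p :* (e :* x)) refl ε (ε ^ℚ K) (ℕ→ℚ n) ⟩
  ε ^ℚ K * (ε * ℕ→ℚ n)      ∎)
  where
  open ℚ.≤-Reasoning
  open ℚSolver.+-*-Solver
  q K 4K : ℕ
  q = m +ℕ m
  K = 2 ^ℕ k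
  4K = 2 ^ℕ (k +ℕ 2)
  0≤ε : 0ℚ ≤ ε
  0≤ε = ℚ.<⇒≤ 0<ε
  0≤εq : 0ℚ ≤ ε * ℕ→ℚ q
  0≤εq = ℚ.nonNegative⁻¹ _ {{ℚ.nonNeg*nonNeg⇒nonNeg ε {{nonNegative 0≤ε}} (ℕ→ℚ q) {{ℕ→ℚ-nonNeg q}}}}
  εq≤2 : ε * ℕ→ℚ q ≤ ℕ→ℚ 2
  εq≤2 = begin
    ε * ℕ→ℚ q                    ≡⟨ cong (ε *_) (ℕ→ℚ-+ m m) ⟩
    ε * (ℕ→ℚ m + ℕ→ℚ m)          ≡⟨ solve 2 (λ e x → e :* (x :+ x) := x :* e :+ x :* e) refl ε (ℕ→ℚ m) ⟩
    ℕ→ℚ m * ε + ℕ→ℚ m * ε        ≤⟨ ℚ.+-mono-≤ mε≤1 mε≤1 ⟩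
    1ℚ + 1ℚ                      ∎
  1+K≤4K : suc K ≤ℕ 4K
  1+K≤4K = ℕ.^-monoʳ-< 2 (s≤s (s≤s z≤n)) (ℕ.m<m+n k (s≤s z≤n))

+-cancelʳ-≤ : ∀ r {p q} → p + r ≤ q + r → p ≤ q
+-cancelʳ-≤ r {p} {q} p+r≤q+r = subst₂ _≤_ (add-sub p r) (add-sub q r) (ℚ.+-monoˡ-≤ (- r) p+r≤q+r)
  where
  open ℚSolver.+-*-Solver
  add-sub : ∀ p r → p + r - r ≡ p
  add-sub = solve 2 (λ p r → p :+ r :- r := p) refl

-- With `s = 2m + 1`, the hypotheses give `s L ≤ (m + 1) n + m ε n`, while the target is
-- `s (½ + ε) n = (m + ½) n + (2m + 1) ε n`. The missing `½ n` is paid for by `(m + 1) ε n ≥ n`.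
ranking-size-bound : ∀ {ε} L g m n B → n ≤ℕ g *ℕ suc (m +ℕ m) +ℕ B → L +ℕ g *ℕ m ≤ℕ n →
  ℕ→ℚ B ≤ ε * ℕ→ℚ n → 1ℚ ≤ ℕ→ℚ (suc m) * ε → ℕ→ℚ L ≤ (½ + ε) * ℕ→ℚ n
-- Adding `M * N + ½ * N` to both sides lets `counted` and `half` be summed without subtraction.
ranking-size-bound {ε} L g m n B n≤ L≤ B≤ 1≤ = ℚ.*-cancelˡ-≤-pos S {{S>0}} (+-cancelʳ-≤ (M * N + ½ * N) (begin
  S * ℓ + (M * N + ½ * N)                     ≡⟨ ℚ.+-assoc (S * ℓ) (M * N) (½ * N) ⟨
  S * ℓ + M * N + ½ * N                       ≤⟨ ℚ.+-mono-≤ counted half ⟩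
  S * N + M * (ε * N) + (1ℚ + M) * ε * N      ≡⟨ regroup ½ M N ε ⟩
  (½ + M) * N + S * (ε * N) + (M * N + ½ * N) ≡⟨ cong (_+ (M * N + ½ * N)) halve ⟨
  S * ((½ + ε) * N) + (M * N + ½ * N)         ∎))
  where
  open ℚ.≤-Reasoning
  open ℚSolver.+-*-Solver
  ℓ M N S : ℚ
  ℓ = ℕ→ℚ L
  M = ℕ→ℚ m
  N = ℕ→ℚ n
  S = 1ℚ + (M + M)
  s : ℕ
  s = suc (m +ℕ m)
  -- Used with h = ½, for which h + h computes to 1.
  regroup : ∀ h M N e → (h + h + (M + M)) * N + M * (e * N) + (h + h + M) * e * N ≡
    (h + M) * N + (h + h + (M + M)) * (e * N) + (M * N + h * N)
  regroup = solve 4 (λ h M N e →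
    (h :+ h :+ (M :+ M)) :* N :+ M :* (e :* N) :+ (h :+ h :+ M) :* e :* N :=
    (h :+ M) :* N :+ (h :+ h :+ (M :+ M)) :* (e :* N) :+ (M :* N :+ h :* N)) refl
  ½S : S * ½ ≡ ½ + M
  ½S = begin-equality
    S * ½                 ≡⟨ ℚ.*-comm S ½ ⟩
    ½ * S                 ≡⟨ ℚ.*-distribˡ-+ ½ 1ℚ (M + M) ⟩
    ½ + ½ * (M + M)       ≡⟨ cong (½ +_) (ℚ.*-distribˡ-+ ½ M M) ⟩
    ½ + (½ * M + ½ * M)   ≡⟨ cong (½ +_) (ℚ.*-distribʳ-+ M ½ ½) ⟨
    ½ + 1ℚ * M            ≡⟨ cong (½ +_) (ℚ.*-identityˡ M) ⟩
    ½ + M                 ∎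
  halve : S * ((½ + ε) * N) ≡ (½ + M) * N + S * (ε * N)
  halve = begin-equality
    S * ((½ + ε) * N)           ≡⟨ solve 4 (λ S h e N → S :* ((h :+ e) :* N) := S :* h :* N :+ S :* (e :* N)) refl S ½ ε N ⟩
    S * ½ * N + S * (ε * N)     ≡⟨ cong (λ t → t * N + S * (ε * N)) ½S ⟩
    (½ + M) * N + S * (ε * N)   ∎
  s≡S : ℕ→ℚ s ≡ S
  s≡S = trans (ℕ→ℚ-+ 1 (m +ℕ m)) (cong (1ℚ +_) (ℕ→ℚ-+ m m))
  S>0 : Positive S
  S>0 = positive (ℚ.<-≤-trans (ℚ.positive⁻¹ 1ℚ) (subst (1ℚ ≤_) s≡S (ℕ→ℚ-mono {1} {s} (s≤s z≤n))))
  -- The covering bound is used `m` times and the matching bound `s` times; the terms `g * s * m`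
  -- then agree and `g` drops out.
  countedℕ : s *ℕ L +ℕ m *ℕ n ≤ℕ s *ℕ n +ℕ m *ℕ B
  countedℕ = ≤R.begin
    s *ℕ L +ℕ m *ℕ n                     ≤R.≤⟨ ℕ.+-monoʳ-≤ (s *ℕ L) (ℕ.*-monoʳ-≤ m n≤) ⟩
    s *ℕ L +ℕ m *ℕ (g *ℕ s +ℕ B)         ≤R.≡⟨ ℕS.solve 5 (λ s L m g B → s ℕS.:* L ℕS.:+ m ℕS.:* (g ℕS.:* s ℕS.:+ B) ℕS.:= s ℕS.:* (L ℕS.:+ g ℕS.:* m) ℕS.:+ m ℕS.:* B) refl s L m g B ⟩
    s *ℕ (L +ℕ g *ℕ m) +ℕ m *ℕ B         ≤R.≤⟨ ℕ.+-monoˡ-≤ (m *ℕ B) (ℕ.*-monoʳ-≤ s L≤) ⟩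
    s *ℕ n +ℕ m *ℕ B                     ≤R.∎
    where
    module ≤R = ℕ.≤-Reasoning
    module ℕS = ℕSolver.+-*-Solver
  cast-sum : ∀ a b c d → ℕ→ℚ (a *ℕ b +ℕ c *ℕ d) ≡ ℕ→ℚ a * ℕ→ℚ b + ℕ→ℚ c * ℕ→ℚ d
  cast-sum a b c d = trans (ℕ→ℚ-+ (a *ℕ b) (c *ℕ d)) (cong₂ _+_ (ℕ→ℚ-* a b) (ℕ→ℚ-* c d))
  counted : S * ℓ + M * N ≤ S * N + M * (ε * N)
  counted = begin
    S * ℓ + M * N                     ≡⟨ cong (λ t → t * ℓ + M * N) s≡S ⟨
    ℕ→ℚ s * ℓ + M * N                 ≡⟨ cast-sum s L m n ⟨
    ℕ→ℚ (s *ℕ L +ℕ m *ℕ n)            ≤⟨ ℕ→ℚ-mono countedℕ ⟩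
    ℕ→ℚ (s *ℕ n +ℕ m *ℕ B)            ≡⟨ cast-sum s n m B ⟩
    ℕ→ℚ s * N + M * ℕ→ℚ B             ≡⟨ cong (λ t → t * N + M * ℕ→ℚ B) s≡S ⟩
    S * N + M * ℕ→ℚ B                 ≤⟨ ℚ.+-monoʳ-≤ (S * N) (ℚ.*-monoˡ-≤-nonNeg M {{ℕ→ℚ-nonNeg m}} B≤) ⟩
    S * N + M * (ε * N)               ∎
  half : ½ * N ≤ (1ℚ + M) * ε * N
  half = ℚ.*-monoʳ-≤-nonNeg N {{ℕ→ℚ-nonNeg n}} {½} {(1ℚ + M) * ε} (begin
    ½                    ≤⟨ *≤* (ℤ.+≤+ (s≤s z≤n)) ⟩
    1ℚ                   ≤⟨ 1≤ ⟩
    ℕ→ℚ (suc m) * ε      ≡⟨ cong (_* ε) (ℕ→ℚ-+ 1 m) ⟩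
    (1ℚ + M) * ε         ∎)

-- The cases of small and large ε

ranking-half : ∀ {ε} → 0ℚ < ε → ε ≤ 1ℚ → ∀ n k →
  ℕ→ℚ 2 ^ℚ (2 ^ℕ (k +ℕ 2)) ≤ ε ^ℚ (2 ^ℕ (k +ℕ 2)) * ℕ→ℚ n →
  (σ : Fin k → Permutation′ n) (π : Permutation′ n) →
  Σ (BipGraph n) λ G → HasPerfectMatching G ×
    (∀ i → ℕ→ℚ (length (Ranking G π (σ i))) ≤ (½ + ε) * ℕ→ℚ n)
ranking-half {ε} 0<ε ε≤1 n k large σ π = fromFloor (floor-inverse ε 0<ε)
  where
  fromFloor : (∃ λ m → ℕ→ℚ m * ε ≤ 1ℚ × 1ℚ ≤ ℕ→ℚ (suc m) * ε) →
    Σ (BipGraph n) λ G → HasPerfectMatching G ×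
      (∀ i → ℕ→ℚ (length (Ranking G π (σ i))) ≤ (½ + ε) * ℕ→ℚ n)
  fromFloor (m , mε≤1 , 1≤) =
    let G , pm , g , n≤ , L≤ = adversarial-graph m k σ π in
    G , pm , λ i → ranking-size-bound (length (Ranking G π (σ i))) g m n ((m +ℕ m) ^ℕ (2 ^ℕ k)) n≤ (L≤ i)
      (chain-threshold≤εn m n k 0<ε ε≤1 mε≤1 large) 1≤

ranking-trivial : ∀ {ε} → 1ℚ ≤ ε → ∀ {n} (G : BipGraph n) (π σ : Permutation′ n) →
  ℕ→ℚ (length (Ranking G π σ)) ≤ (½ + ε) * ℕ→ℚ n
ranking-trivial {ε} 1≤ε {n} G π σ = begin
  ℕ→ℚ (length (Ranking G π σ))   ≤⟨ ℕ→ℚ-mono (length-Ranking≤n G π σ) ⟩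
  ℕ→ℚ n                          ≡⟨ ℚ.*-identityˡ (ℕ→ℚ n) ⟨
  1ℚ * ℕ→ℚ n                     ≤⟨ ℚ.*-monoʳ-≤-nonNeg (ℕ→ℚ n) {{ℕ→ℚ-nonNeg n}} 1≤½+ε ⟩
  (½ + ε) * ℕ→ℚ n                ∎
  where
  open ℚ.≤-Reasoning
  1≤½+ε : 1ℚ ≤ ½ + ε
  1≤½+ε = begin
    1ℚ       ≤⟨ 1≤ε ⟩
    ε        ≡⟨ ℚ.+-identityˡ ε ⟨
    0ℚ + ε   ≤⟨ ℚ.+-monoˡ-≤ ε (ℚ.nonNegative⁻¹ ½) ⟩
    ½ + ε    ∎

theorem13 : (ε : ℚ) → 0ℚ < ε → ε < ℕ→ℚ 2 →
    Σ (ℕ → ℚ) λ f →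
      -- f(n) = o(n)
      ((δ : ℚ) → 0ℚ < δ → Σ ℕ λ N → (n : ℕ) → N Data.Nat.≤ n → f n ≤ δ * (ℕ→ℚ n))
      ×
      ((n k : ℕ) →
        -- k ≤ log log n − log log (2/ε) − 2  ⇔  n ≥ (2/ε)^(2^(k+2))  ⇔  ε^(2^(k+2)) · n ≥ 2^(2^(k+2))
        (ε ^ℚ (2 ^ℕ (k +ℕ 2))) * (ℕ→ℚ n) ≥ (ℕ→ℚ 2) ^ℚ (2 ^ℕ (k +ℕ 2)) →
        (σ : Fin k → Permutation′ n) → (π : Permutation′ n) →
        Σ (BipGraph n) λ G →
          HasPerfectMatching G ×
          ((i : Fin k) → ℕ→ℚ (length (Ranking G π (σ i))) ≤ (½ + ε) * (ℕ→ℚ n) + f n))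
theorem13 ε 0<ε _ = (λ _ → 0ℚ) , o-term , λ n k large σ π →
  let G , pm , bound = construct n k large σ π (ℚ.≤-total ε 1ℚ) in
  G , pm , λ i → subst (ℕ→ℚ (length (Ranking G π (σ i))) ≤_) (sym (ℚ.+-identityʳ ((½ + ε) * ℕ→ℚ n))) (bound i)
  where
  o-term : (δ : ℚ) → 0ℚ < δ → Σ ℕ λ N → (n : ℕ) → N ≤ℕ n → 0ℚ ≤ δ * ℕ→ℚ n
  o-term δ 0<δ = 0 , λ n _ → ℚ.nonNegative⁻¹ (δ * ℕ→ℚ n)
    {{ℚ.nonNeg*nonNeg⇒nonNeg δ {{nonNegative (ℚ.<⇒≤ 0<δ)}} (ℕ→ℚ n) {{ℕ→ℚ-nonNeg n}}}}
  construct : ∀ n k → ℕ→ℚ 2 ^ℚ (2 ^ℕ (k +ℕ 2)) ≤ ε ^ℚ (2 ^ℕ (k +ℕ 2)) * ℕ→ℚ n →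
    (σ : Fin k → Permutation′ n) (π : Permutation′ n) → ε ≤ 1ℚ ⊎ 1ℚ ≤ ε →
    Σ (BipGraph n) λ G → HasPerfectMatching G ×
      (∀ i → ℕ→ℚ (length (Ranking G π (σ i))) ≤ (½ + ε) * ℕ→ℚ n)
  construct n k large σ π (inj₁ ε≤1) = ranking-half 0<ε ε≤1 n k large σ π
  -- The estimate for small `ε` relies on powers of `ε` decreasing, hence the case split. For
  -- `ε ≥ 1` the bound is at least `n` and any graph with a perfect matching serves; with `m = 0`
  -- there are no gadget rows and the graph is just a perfect matching.
  construct n k large σ π (inj₂ 1≤ε) =
    let G , pm , _ = adversarial-graph 0 k σ π in G , pm , λ i → ranking-trivial 1≤ε G π (σ i)
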